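{- Let $L$ be a finite relational language and $\mathbb X,\mathbb Y$ be $L$-structures. (I) The following are equivalent: (a) $\mathbb X\preccurlyeq_c^{\mathrm{fin}}\mathbb Y$, i.e. there is a sequence $\langle\Pi_r:r<\omega\rangle$ of nonempty subsets of $\mathrm{PC}(\mathbb X,\mathbb Y)$ such that for every $r<\omega$: (f1) for all $f\in\Pi_{r+1}$ and $x\in X$ there is $g\in\Pi_r$ with $x\in\operatorname{dom}g$ and $f\subseteq g$, and (f2) for all $f\in\Pi_{r+1}$ and $y\in Y$ there is $g\in\Pi_r$ with $y\in\operatorname{ran}g$ and $f\subseteq g$; (b) for each $n\in\omega$, player II has a winning strategy in the game $G^{\preccurlyeq_c}_n(\mathbb X,\mathbb Y)$; (c) $\mathbb X\lll_{\mathcal P}\mathbb Y$; (d) $\mathbb Y\lll_{\mathcal N}\mathbb X$. (II) The following are equivalent: (a) $\mathbb X\preccurlyeq_c^{\mathrm{fin}}\mathbb Y$ and $\mathbb Y\preccurlyeq_c^{\mathrm{fin}}\mathbb X$; (b) for each $n\in\omega$, player II has winning strategies in both $G^{\preccurlyeq_c}_n(\mathbb X,\mathbb Y)$ and $G^{\preccurlyeq_c}_n(\mathbb Y,\mathbb X)$; (c) $\mathbb X\equiv_{\mathcal P}\mathbb Y$; (d) $\mathbb X\equiv_{\mathcal N}\mathbb Y$; (e) $\mathbb X\equiv_{\mathcal P\cup\mathcal N}\mathbb Y$; (f) $\mathbb X\lll_{\mathcal P\cup\mathcal N}\mathbb Y$.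
   Context: $L=\langle R_i:i\in I\rangle$ is a relational language, $R_i$ of arity $n_i$; for an $L$-structure $\mathbb X$ with domain $X$, $R_i^{\mathbb X}$ is the interpretation of $R_i$. For a map $f$ and tuple $\bar x=\langle x_0,\dots,x_{k-1}\rangle$ write $f\bar x=\langle f(x_0),\dots,f(x_{k-1})\rangle$. A partial condensation from $\mathbb X$ to $\mathbb Y$ is a bijection $f$ from a set $\operatorname{dom}f\subseteq X$ onto a set $\operatorname{ran}f\subseteq Y$ such that for all $i\in I$ and $\bar x\in(\operatorname{dom}f)^{n_i}$, $\bar x\in R_i^{\mathbb X}$ implies $f\bar x\in R_i^{\mathbb Y}$; $\mathrm{PC}(\mathbb X,\mathbb Y)$ is the set of these. For $n\in\omega$, the game $G^{\preccurlyeq_c}_n(\mathbb X,\mathbb Y)$ has $n$ steps $k<n$; at step $k$ player I either chooses $x_k\in X$ and then player II chooses $y_k\in Y$, or player I chooses $y_k\in Y$ and then II chooses $x_k\in X$. Player II wins iff $\{\langle x_k,y_k\rangle:k<n\}\in\mathrm{PC}(\mathbb X,\mathbb Y)$. A strategy for II determines its move from the previous moves and I's current choice; it is winning if II wins every play in which it is followed. Formula classes: $\mathcal P_0$ consists of all atomic formulas ($v_\alpha=v_\beta$, $R_i(v_{\alpha_1},\dots,v_{\alpha_{n_i}})$) and all $\neg\,v_\alpha=v_\beta$. $\mathcal N_0$ consists of all $\neg R_i(v_{\alpha_1},\dots,v_{\alpha_{n_i}})$, all $v_\alpha=v_\beta$ and all $\neg\,v_\alpha=v_\beta$. $\mathcal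 P$ (resp. $\mathcal N$), the $R$-positive (resp. $R$-negative) first order formulas, is the closure of $\mathcal P_0$ (resp. $\mathcal N_0$) under finite conjunctions, finite disjunctions, $\forall v$ and $\exists v$ (no negation). For a class $\mathcal F$ of formulas, $\mathbb X\lll_{\mathcal F}\mathbb Y$ means every sentence of $\mathcal F$ true in $\mathbb X$ is true in $\mathbb Y$, and $\mathbb X\equiv_{\mathcal F}\mathbb Y$ means they satisfy the same sentences of $\mathcal F$. -}

module Defs where

open import Level using (Level; suc)
open import Data.Nat.Base as ℕ using (ℕ)
open import Data.Fin.Base using (Fin; Fin′; toℕ; inject)
open import Data.Vec.Base using (Vec; map; lookup; tabulate; _∷_; [])
open import Data.Vec.Relation.Binary.Pointwise.Inductive using (Pointwise)
open import Data.Product.Base using (Σ; ∃; _×_; _,_; proj₁; proj₂)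
open import Data.Sum.Base using (_⊎_; inj₁; inj₂)
open import Function.Bundles using (_⇔_; _↔_)
open import Relation.Binary.Core using (REL; _⇒_)
open import Relation.Binary.PropositionalEquality.Core using (_≡_)
open import Relation.Nullary.Negation.Core using (¬_)
open import Relation.Unary using (Pred; _∈_)

private
  variable
    ℓ : Level

record Language : Set₁ where
  field
    Index : Set
    arity : Index → ℕ

open Language public

IsFinite : Language → Set
IsFinite L = ∃ λ m → Index L ↔ Fin m

record Structure (L : Language) (ℓ : Level) : Set (suc ℓ) where
  field
    Carrier : Set ℓ
    interp  : (i : Index L) → Pred (Vec Carrier (arity L i)) ℓ

open Structure public

-- A partial map is represented by its graph, a set of pairs.

dom : {A B : Set ℓ} → REL A B ℓ → Pred A ℓ
dom f x = ∃ λ y → f x y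

ran : {A B : Set ℓ} → REL A B ℓ → Pred B ℓ
ran f y = ∃ λ x → f x y

module _ {L : Language} (𝕏 𝕐 : Structure L ℓ) where

  private
    X = Carrier 𝕏
    Y = Carrier 𝕐

  -- `functional` and `injective` say that f is the graph of a bijection from
  -- dom f onto ran f.  In `preserves`, Pointwise f xs ys says that xs is a
  -- tuple of elements of dom f and that ys is its image.

  record IsPartialCondensation (f : REL X Y ℓ) : Set ℓ where
    field
      functional : ∀ {x y y′} → f x y → f x y′ → y ≡ y′
      injective  : ∀ {x x′ y} → f x y → f x′ y → x ≡ x′
      preserves  : ∀ i {xs : Vec X (arity L i)} {ys : Vec Y (arity L i)} →
                   Pointwise f xs ys → xs ∈ interp 𝕏 i → ys ∈ interp 𝕐 i

  PC : Set (suc ℓ)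
  PC = Σ (REL X Y ℓ) IsPartialCondensation

  graph : PC → REL X Y ℓ
  graph = proj₁

  record IsBackAndForthSequence (Π : ℕ → Pred PC ℓ) : Set (suc ℓ) where
    field
      nonempty : ∀ r → ∃ λ f → f ∈ Π r
      forth    : ∀ r f → f ∈ Π (ℕ.suc r) → ∀ (x : X) →
                 ∃ λ g → g ∈ Π r × x ∈ dom (graph g) × (graph f ⇒ graph g)
      back     : ∀ r f → f ∈ Π (ℕ.suc r) → ∀ (y : Y) →
                 ∃ λ g → g ∈ Π r × y ∈ ran (graph g) × (graph f ⇒ graph g)

  infix 4 _≼ᶜ-fin_

  _≼ᶜ-fin_ : Set (suc ℓ)
  _≼ᶜ-fin_ = ∃ λ Π → IsBackAndForthSequence Π

  -- Player I's choice: an element of X (inj₁) or an element of Y (inj₂);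
  -- player II replies in the other structure.

  Move : Set ℓ
  Move = X ⊎ Y

  Reply : Move → Set ℓ
  Reply (inj₁ _) = Y
  Reply (inj₂ _) = X

  Round : Set ℓ
  Round = Σ Move Reply

  xOf : Round → X
  xOf (inj₁ x , _) = x
  xOf (inj₂ _ , x) = x

  yOf : Round → Y
  yOf (inj₁ _ , y) = y
  yOf (inj₂ y , _) = y

  Play : ℕ → Set ℓ
  Play n = Fin n → Round

  pairs : ∀ {n} → Play n → REL X Y ℓ
  pairs π x y = ∃ λ k → x ≡ xOf (π k) × y ≡ yOf (π k)

  WinsII : ∀ {n} → Play n → Set ℓ
  WinsII π = IsPartialCondensation (pairs π)

  -- At step k < n: the k earlier rounds and I's current choice determine
  -- II's reply.

  Strategy : ℕ → Set ℓ
  Strategy n = (k : Fin n) → Vec Round (toℕ k) → (m : Move) → Reply m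

  earlier : ∀ {n} → Play n → (k : Fin n) → Vec Round (toℕ k)
  earlier π k = tabulate λ (j : Fin′ k) → π (inject j)

  Follows : ∀ {n} → Strategy n → Play n → Set ℓ
  Follows σ π = ∀ k → proj₂ (π k) ≡ σ k (earlier π k) (proj₁ (π k))

  IsWinning : ∀ {n} → Strategy n → Set ℓ
  IsWinning σ = ∀ π → Follows σ π → WinsII π

  HasWinningStrategyII : ℕ → Set ℓ
  HasWinningStrategyII n = ∃ λ (σ : Strategy n) → IsWinning σ

-- First order formulas whose free variables are among v₀, …, vₙ₋₁, with de
-- Bruijn binding: a quantifier binds variable zero of its body.

infix  8 _≐_
infix  7 ~_
infixr 6 _∧′_
infixr 5 _∨′_

data Formula (L : Language) (n : ℕ) : Set where
  _≐_       : Fin n → Fin n → Formula L n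
  rel       : (i : Index L) → Vec (Fin n) (arity L i) → Formula L n
  ~_        : Formula L n → Formula L n
  _∧′_ _∨′_ : Formula L n → Formula L n → Formula L n
  ∀′ ∃′     : Formula L (ℕ.suc n) → Formula L n

Sentence : Language → Set
Sentence L = Formula L 0

FormulaClass : Language → Set₁
FormulaClass L = ∀ n → Pred (Formula L n) Level.zero

data P₀ {L : Language} : FormulaClass L where
  eq  : ∀ {n} (a b : Fin n) → P₀ n (a ≐ b)
  rel : ∀ {n} i (as : Vec (Fin n) (arity L i)) → P₀ n (rel i as)
  neq : ∀ {n} (a b : Fin n) → P₀ n (~ (a ≐ b))

data N₀ {L : Language} : FormulaClass L where
  nrel : ∀ {n} i (as : Vec (Fin n) (arity L i)) → N₀ n (~ rel i as)
  eq   : ∀ {n} (a b : Fin n) → N₀ n (a ≐ b)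
  neq  : ∀ {n} (a b : Fin n) → N₀ n (~ (a ≐ b))

data Closure {L : Language} (B : FormulaClass L) : FormulaClass L where
  base : ∀ {n φ} → B n φ → Closure B n φ
  conj : ∀ {n φ ψ} → Closure B n φ → Closure B n ψ → Closure B n (φ ∧′ ψ)
  disj : ∀ {n φ ψ} → Closure B n φ → Closure B n ψ → Closure B n (φ ∨′ ψ)
  univ : ∀ {n φ} → Closure B (ℕ.suc n) φ → Closure B n (∀′ φ)
  exis : ∀ {n φ} → Closure B (ℕ.suc n) φ → Closure B n (∃′ φ)

𝒫 : ∀ {L} → FormulaClass L
𝒫 = Closure P₀

𝒩 : ∀ {L} → FormulaClass L
𝒩 = Closure N₀

infixr 6 _∪ᶜ_

_∪ᶜ_ : ∀ {L} → FormulaClass L → FormulaClass L → FormulaClass L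
(F ∪ᶜ G) n φ = F n φ ⊎ G n φ

Sat : ∀ {L n} (𝕏 : Structure L ℓ) → Vec (Carrier 𝕏) n → Formula L n → Set ℓ
Sat 𝕏 ρ (a ≐ b)    = lookup ρ a ≡ lookup ρ b
Sat 𝕏 ρ (rel i as) = map (lookup ρ) as ∈ interp 𝕏 i
Sat 𝕏 ρ (~ φ)      = ¬ Sat 𝕏 ρ φ
Sat 𝕏 ρ (φ ∧′ ψ)   = Sat 𝕏 ρ φ × Sat 𝕏 ρ ψ
Sat 𝕏 ρ (φ ∨′ ψ)   = Sat 𝕏 ρ φ ⊎ Sat 𝕏 ρ ψ
Sat 𝕏 ρ (∀′ φ)     = ∀ x → Sat 𝕏 (x ∷ ρ) φ
Sat 𝕏 ρ (∃′ φ)     = ∃ λ x → Sat 𝕏 (x ∷ ρ) φ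

infix 4 _⊨_ _⋘[_]_ _≡[_]_

_⊨_ : ∀ {L} → Structure L ℓ → Sentence L → Set ℓ
𝕏 ⊨ φ = Sat 𝕏 [] φ

_⋘[_]_ : ∀ {L} → Structure L ℓ → FormulaClass L → Structure L ℓ → Set ℓ
𝕏 ⋘[ F ] 𝕐 = ∀ φ → F 0 φ → 𝕏 ⊨ φ → 𝕐 ⊨ φ

_≡[_]_ : ∀ {L} → Structure L ℓ → FormulaClass L → Structure L ℓ → Set ℓ
𝕏 ≡[ F ] 𝕐 = ∀ φ → F 0 φ → (𝕏 ⊨ φ ⇔ 𝕐 ⊨ φ)

{-# OPTIONS --safe #-}
-- All conditions are compared with one relation: BackForth r xs ys says that
-- the finite map xs ↦ ys is a partial condensation which can be extended r
-- more times, back and forth.  Being defined by recursion on r, it stays at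
-- the level of the structures, where excluded middle is available.  The step
-- from 𝒫-preservation to BackForth r uses that, L being finite, finitely many
-- positive formulas suffice at each rank: after a move x in 𝕏, a reply is a
-- witness in 𝕐 of ∃ ⋀ S for S the formulas of lower rank true at x; after a
-- move y in 𝕐, a reply is a counterexample in 𝕏 to ∀ ⋁ S for S the formulas
-- of lower rank false at y.  The statements about 𝒩 follow by exchanging
-- a formula for the negation normal form of its negation.
module Submission where

open import Defs
open import Axiom.DoubleNegationElimination using (em⇒dne)
open import Axiom.ExcludedMiddle using (ExcludedMiddle)
open import Data.Empty using (⊥-elim)
open import Data.Fin.Base using (Fin; zero; suc)
open import Data.List.Base as List
  using (List; []; _∷_; _++_; allFin; cartesianProductWith; concatMap; filter; foldr)
open import Data.List.Membership.Propositional using (lose) renaming (_∈_ to _∈ₗ_)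
open import Data.List.Membership.Propositional.Properties
  using (∈-allFin; ∈-cartesianProductWith⁺; ∈-concatMap⁺; ∈-filter⁺; ∈-map⁺; ∈-++⁺ˡ; ∈-++⁺ʳ)
open import Data.List.Relation.Unary.All as All using (All; []; _∷_)
open import Data.List.Relation.Unary.All.Properties using (all-filter; All¬⇒¬Any)
open import Data.List.Relation.Unary.Any as Any using (Any; here; there)
open import Data.Nat.Base using (ℕ; zero; suc; _≤_; s≤s; _⊔_)
open import Data.Nat.Properties using (≤-refl; m⊔n≤o⇒m≤o; m⊔n≤o⇒n≤o)
open import Data.Product.Base using (∃; ∃₂; _×_; _,_; proj₁; proj₂; swap; map₂)
open import Data.Sum.Base using (_⊎_; inj₁; inj₂; [_,_])
open import Data.Vec.Base as Vec using (Vec; []; _∷_; lookup)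
open import Data.Vec.Relation.Binary.Pointwise.Inductive as Pointwise using (Pointwise; []; _∷_)
import Data.Vec.Functional as Functional
open import Function.Base using (_∘_; id)
open import Function.Bundles using (_⇔_; mk⇔; Equivalence; Inverse)
open import Function.Construct.Composition using (_⇔-∘_)
open import Function.Construct.Symmetry using (⇔-sym)
open import Data.Product.Function.NonDependent.Propositional using (_×-⇔_)
open import Level using (Level)
open import Relation.Binary.Core using (REL; _⇒_)
open import Relation.Binary.PropositionalEquality.Core using (_≡_; refl; sym; trans; cong; cong₂; subst)
open import Relation.Nullary.Decidable.Core using (yes; no)
open import Relation.Nullary.Negation.Core using (¬_)
open import Relation.Unary using (Pred; Decidable; _∈_)

private
  variable
    ℓ : Level
    A : Set ℓ
    L : Language
    k n r : ℕ

open Equivalence using (to; from)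

-- Back-and-forth systems

-- Entries may repeat, so the same two vectors can serve as a game position and as a pair of
-- variable assignments.
Link : {A B : Set ℓ} → Vec A k → Vec B k → REL A B ℓ
Link xs ys x y = ∃ λ a → x ≡ lookup xs a × y ≡ lookup ys a

Link-weaken : {A B : Set ℓ} (xs : Vec A k) (ys : Vec B k) {x : A} {y : B} →
              Link xs ys ⇒ Link (x ∷ xs) (y ∷ ys)
Link-weaken xs ys (a , p) = suc a , p

Link-cons : {A B : Set ℓ} {xs : Vec A k} {ys : Vec B k} {x : A} {y : B} {R : REL A B ℓ} →
            R x y → Link xs ys ⇒ R → Link (x ∷ xs) (y ∷ ys) ⇒ R
Link-cons Rxy sub (zero  , refl , refl) = Rxy
Link-cons Rxy sub (suc a , p)           = sub (a , p)

Link-pointwise : {A B : Set ℓ} (xs : Vec A k) (ys : Vec B k) (as : Vec (Fin k) n) →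
                 Pointwise (Link xs ys) (Vec.map (lookup xs) as) (Vec.map (lookup ys) as)
Link-pointwise xs ys []       = []
Link-pointwise xs ys (a ∷ as) = (a , refl , refl) ∷ Link-pointwise xs ys as

-- Naming the entries of a tuple by variables turns `preserves` into a statement about the atomic
-- formulas `rel i as`.
Link-indices : {A B : Set ℓ} (xs : Vec A k) (ys : Vec B k) {us : Vec A n} {vs : Vec B n} →
               Pointwise (Link xs ys) us vs →
               ∃ λ as → us ≡ Vec.map (lookup xs) as × vs ≡ Vec.map (lookup ys) as
Link-indices xs ys []                = [] , refl , refl
Link-indices xs ys ((a , p , q) ∷ l) with as , ps , qs ← Link-indices xs ys l =
  a ∷ as , cong₂ _∷_ p ps , cong₂ _∷_ q qs

module _ (𝕏 𝕐 : Structure L ℓ) where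

  private
    X = Carrier 𝕏
    Y = Carrier 𝕐

  open IsPartialCondensation
  open IsBackAndForthSequence

  isPartialCondensation-⊆ : {f g : REL X Y ℓ} → f ⇒ g →
                            IsPartialCondensation 𝕏 𝕐 g → IsPartialCondensation 𝕏 𝕐 f
  isPartialCondensation-⊆ f⊆g pc .functional p q = pc .functional (f⊆g p) (f⊆g q)
  isPartialCondensation-⊆ f⊆g pc .injective  p q = pc .injective (f⊆g p) (f⊆g q)
  isPartialCondensation-⊆ f⊆g pc .preserves i ps = pc .preserves i (Pointwise.map f⊆g ps)

  BackForth : ℕ → Vec X k → Vec Y k → Set ℓ
  BackForth zero    xs ys = IsPartialCondensation 𝕏 𝕐 (Link xs ys)
  BackForth (suc r) xs ys =
    IsPartialCondensation 𝕏 𝕐 (Link xs ys)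
    × (∀ x → ∃ λ y → BackForth r (x ∷ xs) (y ∷ ys))
    × (∀ y → ∃ λ x → BackForth r (x ∷ xs) (y ∷ ys))

  BackForth⇒isPartialCondensation : ∀ r {xs : Vec X k} {ys : Vec Y k} →
    BackForth r xs ys → IsPartialCondensation 𝕏 𝕐 (Link xs ys)
  BackForth⇒isPartialCondensation zero    pc       = pc
  BackForth⇒isPartialCondensation (suc r) (pc , _) = pc

  -- Members of the sequence may be infinite maps, so only an inclusion of the finite map is carried
  -- along; each step picks one pair out of the extension `g`.
  sequence⇒BackForth : ∀ {Π} → IsBackAndForthSequence 𝕏 𝕐 Π →
    ∀ r f → f ∈ Π r → {xs : Vec X k} {ys : Vec Y k} →
    Link xs ys ⇒ graph 𝕏 𝕐 f → BackForth r xs ys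
  sequence⇒BackForth bf zero    f f∈Π sub = isPartialCondensation-⊆ sub (proj₂ f)
  sequence⇒BackForth bf (suc r) f f∈Π sub =
    isPartialCondensation-⊆ sub (proj₂ f) ,
    (λ x → let g , g∈Π , (y , gxy) , f⊆g = bf .forth r f f∈Π x
           in y , sequence⇒BackForth bf r g g∈Π (Link-cons gxy (f⊆g ∘ sub))) ,
    (λ y → let g , g∈Π , (x , gxy) , f⊆g = bf .back r f f∈Π y
           in x , sequence⇒BackForth bf r g g∈Π (Link-cons gxy (f⊆g ∘ sub)))

  -- Inclusion suffices: an extension of the listed pairs also extends every map below them.
  BackForthMaps : ℕ → Pred (PC 𝕏 𝕐) ℓ
  BackForthMaps r f = ∃ λ k → ∃₂ λ (xs : Vec X k) (ys : Vec Y k) →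
    BackForth r xs ys × (graph 𝕏 𝕐 f ⇒ Link xs ys)

  BackForthMaps-isSequence : (∀ r → BackForth r [] []) →
                             IsBackAndForthSequence 𝕏 𝕐 BackForthMaps
  BackForthMaps-isSequence b .nonempty r =
    (_ , BackForth⇒isPartialCondensation r (b r)) , _ , _ , _ , b r , id
  BackForthMaps-isSequence b .forth r f (_ , xs , ys , (_ , fo , _) , sub) x with y , b′ ← fo x =
    (_ , BackForth⇒isPartialCondensation r b′) ,
    (_ , _ , _ , b′ , id) , (y , zero , refl , refl) , Link-weaken xs ys ∘ sub
  BackForthMaps-isSequence b .back r f (_ , xs , ys , (_ , _ , ba) , sub) y with x , b′ ← ba y =
    (_ , BackForth⇒isPartialCondensation r b′) ,
    (_ , _ , _ , b′ , id) , (x , zero , refl , refl) , Link-weaken xs ys ∘ sub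

  ≼ᶜ-fin⇔BackForth : (𝕏 ≼ᶜ-fin 𝕐) ⇔ (∀ r → BackForth r [] [])
  ≼ᶜ-fin⇔BackForth = mk⇔
    (λ (_ , bf) r → let f , f∈Π = bf .nonempty r
                    in sequence⇒BackForth bf r f f∈Π λ { (() , _) })
    (λ b → _ , BackForthMaps-isSequence b)

  -- Games

  -- A game in progress: the pairs played so far count towards the result, as an induction on the
  -- remaining rounds requires.
  WinsFrom : Vec X k → Vec Y k → Strategy 𝕏 𝕐 n → Set ℓ
  WinsFrom xs ys σ = ∀ π → Follows 𝕏 𝕐 σ π →
    IsPartialCondensation 𝕏 𝕐 (λ x y → Link xs ys x y ⊎ pairs 𝕏 𝕐 π x y)

  residual : Strategy 𝕏 𝕐 (suc n) → Round 𝕏 𝕐 → Strategy 𝕏 𝕐 n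
  residual σ ρ j h = σ (suc j) (ρ ∷ h)

  residual-winsFrom : {xs : Vec X k} {ys : Vec Y k} (σ : Strategy 𝕏 𝕐 (suc n)) →
    WinsFrom xs ys σ → (m : Move 𝕏 𝕐) → let ρ = m , σ zero [] m in
    WinsFrom (xOf 𝕏 𝕐 ρ ∷ xs) (yOf 𝕏 𝕐 ρ ∷ ys) (residual σ ρ)
  residual-winsFrom {n = n} σ w m π follows = isPartialCondensation-⊆
    -- The first round passes from the play into the position.
    (λ { (inj₁ (zero  , p)) → inj₂ (zero , p)
       ; (inj₁ (suc a , p)) → inj₁ (a , p)
       ; (inj₂ (j     , p)) → inj₂ (suc j , p) })
    (w π⁺ λ { zero → refl ; (suc j) → follows j })
    where
    π⁺ : Play 𝕏 𝕐 (suc n)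
    π⁺ = (m , σ zero [] m) Functional.∷ π

  -- A nonempty position supplies moves with which any play can be completed.
  winsFrom⇒isPartialCondensation : ∀ n {x y} {xs : Vec X k} {ys : Vec Y k}
    (σ : Strategy 𝕏 𝕐 n) → WinsFrom (x ∷ xs) (y ∷ ys) σ →
    IsPartialCondensation 𝕏 𝕐 (Link (x ∷ xs) (y ∷ ys))
  winsFrom⇒isPartialCondensation zero    σ w = isPartialCondensation-⊆ inj₁ (w (λ ()) λ ())
  winsFrom⇒isPartialCondensation (suc n) {x} {y} {xs} {ys} σ w =
    isPartialCondensation-⊆ (Link-weaken (x ∷ xs) (y ∷ ys))
      (winsFrom⇒isPartialCondensation n (residual σ _) (residual-winsFrom σ w (inj₁ x)))

  -- The position is assumed to be a partial condensation because over two empty structures no play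
  -- of positive length exists to show it.
  winsFrom⇒BackForth : ∀ n {xs : Vec X k} {ys : Vec Y k} (σ : Strategy 𝕏 𝕐 n) →
    IsPartialCondensation 𝕏 𝕐 (Link xs ys) → WinsFrom xs ys σ → BackForth n xs ys
  winsFrom⇒BackForth zero    σ pc w = pc
  winsFrom⇒BackForth (suc n) {xs} {ys} σ pc w =
    pc , (λ x → _ , after (inj₁ x)) , (λ y → _ , after (inj₂ y))
    where
    after : (m : Move 𝕏 𝕐) → let ρ = m , σ zero [] m in
            BackForth n (xOf 𝕏 𝕐 ρ ∷ xs) (yOf 𝕏 𝕐 ρ ∷ ys)
    after m = winsFrom⇒BackForth n σ′ (winsFrom⇒isPartialCondensation n σ′ w′) w′
      where
      σ′ = residual σ (m , σ zero [] m)
      w′ = residual-winsFrom σ w m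

  reply : {xs : Vec X k} {ys : Vec Y k} →
          BackForth (suc r) xs ys → (m : Move 𝕏 𝕐) → Reply 𝕏 𝕐 m
  reply (_ , fo , _) (inj₁ x) = proj₁ (fo x)
  reply (_ , _ , ba) (inj₂ y) = proj₁ (ba y)

  BackForth-reply : {xs : Vec X k} {ys : Vec Y k} (b : BackForth (suc r) xs ys) →
    (m : Move 𝕏 𝕐) → let ρ = m , reply b m in
    BackForth r (xOf 𝕏 𝕐 ρ ∷ xs) (yOf 𝕏 𝕐 ρ ∷ ys)
  BackForth-reply (_ , fo , _) (inj₁ x) = proj₂ (fo x)
  BackForth-reply (_ , _ , ba) (inj₂ y) = proj₂ (ba y)

  -- II's earlier replies are recomputed from I's moves, so that histories in
  -- which II deviated from the strategy need no separate treatment.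
  strategy : {xs : Vec X k} {ys : Vec Y k} → BackForth n xs ys → Strategy 𝕏 𝕐 n
  strategy {n = suc n} b zero    []            m  = reply b m
  strategy {n = suc n} b (suc j) ((m , _) ∷ h) m′ = strategy (BackForth-reply b m) j h m′

  strategy-winsFrom : ∀ n {xs : Vec X k} {ys : Vec Y k} (b : BackForth n xs ys) →
                      WinsFrom xs ys (strategy b)
  strategy-winsFrom zero    b π follows =
    isPartialCondensation-⊆ (λ { (inj₁ p) → p ; (inj₂ (() , _)) }) b
  strategy-winsFrom (suc n) {xs} {ys} b π follows = isPartialCondensation-⊆
    (λ { (inj₁ (a , p))               → inj₁ (suc a , p)
       ; (inj₂ (zero , refl , refl))  → inj₁ (zero , cong (xOf 𝕏 𝕐) first , cong (yOf 𝕏 𝕐) first)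
       ; (inj₂ (suc j , p))           → inj₂ (j , p) })
    (strategy-winsFrom n (BackForth-reply b m) (π ∘ suc) (follows ∘ suc))
    where
    m = proj₁ (π zero)
    -- As the play follows the strategy, II's actual reply is the recomputed one.
    first : π zero ≡ (m , reply b m)
    first = cong (m ,_) (follows zero)

  hasWinningStrategyII⇔BackForth : (∀ n → HasWinningStrategyII 𝕏 𝕐 n) ⇔ (∀ n → BackForth n [] [])
  hasWinningStrategyII⇔BackForth = mk⇔
    (λ win n → winsFrom⇒BackForth n (proj₁ (win n)) (start (win 0))
       λ π follows → isPartialCondensation-⊆ [ (λ { (() , _) }) , id ] (proj₂ (win n) π follows))
    (λ b n → strategy (b n) , λ π follows →
       isPartialCondensation-⊆ inj₂ (strategy-winsFrom n (b n) π follows))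
    where
    -- The game of length 0 has a play even over empty structures; its content is the preservation
    -- of relations of arity 0.
    start : HasWinningStrategyII 𝕏 𝕐 0 → IsPartialCondensation 𝕏 𝕐 (Link [] [])
    start (_ , w) = isPartialCondensation-⊆ (λ { (() , _) }) (w (λ ()) λ ())

-- Preservation of positive formulas

rank : Formula L n → ℕ
rank (_ ≐ _)   = 0
rank (rel _ _) = 0
rank (~ φ)     = rank φ
rank (φ ∧′ ψ)  = rank φ ⊔ rank ψ
rank (φ ∨′ ψ)  = rank φ ⊔ rank ψ
rank (∀′ φ)    = suc (rank φ)
rank (∃′ φ)    = suc (rank φ)

module _ (𝕏 𝕐 : Structure L ℓ) where

  open IsPartialCondensation

  -- Induction on the positive formula: the three clauses of a partial condensation match the three
  -- kinds of `P₀`, and each `∀′` or `∃′` spends one extension, back or forth.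
  BackForth-preserves-𝒫 : ∀ r {xs : Vec (Carrier 𝕏) n} {ys : Vec (Carrier 𝕐) n} {φ} →
    BackForth 𝕏 𝕐 r xs ys → 𝒫 n φ → rank φ ≤ r → Sat 𝕏 xs φ → Sat 𝕐 ys φ
  BackForth-preserves-𝒫 r b (base (eq a c)) _ p =
    BackForth⇒isPartialCondensation 𝕏 𝕐 r b .functional (a , refl , refl) (c , p , refl)
  BackForth-preserves-𝒫 r {xs} {ys} b (base (rel i as)) _ =
    BackForth⇒isPartialCondensation 𝕏 𝕐 r b .preserves i (Link-pointwise xs ys as)
  BackForth-preserves-𝒫 r b (base (neq a c)) _ ¬p q =
    ¬p (BackForth⇒isPartialCondensation 𝕏 𝕐 r b .injective (a , refl , refl) (c , refl , q))
  BackForth-preserves-𝒫 r b (conj {φ = φ} {ψ} p q) h (s , t) =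
    BackForth-preserves-𝒫 r b p (m⊔n≤o⇒m≤o (rank φ) (rank ψ) h) s ,
    BackForth-preserves-𝒫 r b q (m⊔n≤o⇒n≤o (rank φ) (rank ψ) h) t
  BackForth-preserves-𝒫 r b (disj {φ = φ} {ψ} p q) h (inj₁ s) =
    inj₁ (BackForth-preserves-𝒫 r b p (m⊔n≤o⇒m≤o (rank φ) (rank ψ) h) s)
  BackForth-preserves-𝒫 r b (disj {φ = φ} {ψ} p q) h (inj₂ t) =
    inj₂ (BackForth-preserves-𝒫 r b q (m⊔n≤o⇒n≤o (rank φ) (rank ψ) h) t)
  BackForth-preserves-𝒫 (suc r) (_ , _ , ba) (univ p) (s≤s h) s y with x , b ← ba y =
    BackForth-preserves-𝒫 r b p h (s x)
  BackForth-preserves-𝒫 (suc r) (_ , fo , _) (exis p) (s≤s h) (x , s) with y , b ← fo x =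
    y , BackForth-preserves-𝒫 r b p h s

-- Finitely many positive formulas of each rank

tuples : ∀ n k → List (Vec (Fin n) k)
tuples n zero    = [] ∷ []
tuples n (suc k) = cartesianProductWith _∷_ (allFin n) (tuples n k)

∈-tuples : (as : Vec (Fin n) k) → as ∈ₗ tuples n k
∈-tuples []       = here refl
∈-tuples (a ∷ as) = ∈-cartesianProductWith⁺ _∷_ (∈-allFin a) (∈-tuples as)

sublists : List A → List (List A)
sublists []       = [] ∷ []
sublists (x ∷ xs) = sublists xs ++ List.map (x ∷_) (sublists xs)

-- Which formulas hold at an element is not known in advance, so each rank provides for every
-- possible outcome of a `filter`.
filter-∈-sublists : ∀ {p} {P : Pred A p} (P? : Decidable P) xs → filter P? xs ∈ₗ sublists xs
filter-∈-sublists P? []       = here refl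
filter-∈-sublists P? (x ∷ xs) with P? x
... | no  _ = ∈-++⁺ˡ (filter-∈-sublists P? xs)
... | yes _ = ∈-++⁺ʳ (sublists xs) (∈-map⁺ (x ∷_) (filter-∈-sublists P? xs))

-- Carrying the derivation along lets preservation of `𝒫` apply directly to members of a list.
Positive : Language → ℕ → Set
Positive L n = ∃ (𝒫 {L} n)

-- Formula has no constants ⊤ and ⊥; the empty conjunction and the empty
-- disjunction need a variable.
⋀ ⋁ : List (Positive L (suc n)) → Positive L (suc n)
⋀ = foldr (λ (φ , p) (ψ , q) → φ ∧′ ψ , conj p q) (_ , base (eq zero zero))
⋁ = foldr (λ (φ , p) (ψ , q) → φ ∨′ ψ , disj p q) (_ , base (neq zero zero))

∃⋀ ∀⋁ : List (Positive L (suc n)) → Positive L n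
∃⋀ S = _ , exis (proj₂ (⋀ S))
∀⋁ S = _ , univ (proj₂ (⋁ S))

module _ (𝕏 : Structure L ℓ) {n} (ρ : Vec (Carrier 𝕏) (suc n)) where

  private
    True : Positive L (suc n) → Set ℓ
    True (φ , _) = Sat 𝕏 ρ φ

  ⋀⁺ : ∀ {S} → All True S → True (⋀ S)
  ⋀⁺ []       = refl
  ⋀⁺ (s ∷ ss) = s , ⋀⁺ ss

  ⋀⁻ : ∀ S → True (⋀ S) → All True S
  ⋀⁻ []      _        = []
  ⋀⁻ (_ ∷ S) (s , ss) = s ∷ ⋀⁻ S ss

  ⋁⁺ : ∀ {S} → Any True S → True (⋁ S)
  ⋁⁺ (here s)   = inj₁ s
  ⋁⁺ (there ss) = inj₂ (⋁⁺ ss)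

  ⋁⁻ : ∀ S → True (⋁ S) → Any True S
  ⋁⁻ []      ¬refl     = ⊥-elim (¬refl refl)
  ⋁⁻ (_ ∷ S) (inj₁ s)  = here s
  ⋁⁻ (_ ∷ S) (inj₂ ss) = there (⋁⁻ S ss)

module _ {L : Language} (finite : IsFinite L) where

  -- Finiteness of `L` enters through this list.
  indices : List (Index L)
  indices = List.map (Inverse.from (proj₂ finite)) (allFin (proj₁ finite))

  ∈-indices : ∀ i → i ∈ₗ indices
  ∈-indices i = subst (_∈ₗ indices) (Inverse.strictlyInverseʳ (proj₂ finite) i)
    (∈-map⁺ _ (∈-allFin _))

  relAtoms : ∀ n → Index L → List (Positive L n)
  relAtoms n i = List.map (λ as → _ , base (rel i as)) (tuples n (arity L i))

  eqAtoms neqAtoms atoms : ∀ n → List (Positive L n)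
  eqAtoms  n = cartesianProductWith (λ a b → _ , base (eq a b)) (allFin n) (allFin n)
  neqAtoms n = cartesianProductWith (λ a b → _ , base (neq a b)) (allFin n) (allFin n)
  atoms    n = eqAtoms n ++ neqAtoms n ++ concatMap (relAtoms n) indices

  ∈-atoms : ∀ {φ} (p : P₀ n φ) → (φ , base p) ∈ₗ atoms n
  ∈-atoms (eq a b)  = ∈-++⁺ˡ (∈-cartesianProductWith⁺ _ (∈-allFin a) (∈-allFin b))
  ∈-atoms (neq a b) = ∈-++⁺ʳ (eqAtoms _)
    (∈-++⁺ˡ (∈-cartesianProductWith⁺ _ (∈-allFin a) (∈-allFin b)))
  ∈-atoms (rel i as) = ∈-++⁺ʳ (eqAtoms _) (∈-++⁺ʳ (neqAtoms _)
    (∈-concatMap⁺ (relAtoms _)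
      (Any.map (λ { refl → ∈-map⁺ _ (∈-tuples as) }) (∈-indices i))))

  -- Not all formulas of the given rank up to equivalence, only those from which replies are read
  -- off; the atoms recur at each rank to make the current position a partial condensation.
  ranked : ℕ → ∀ n → List (Positive L n)
  ranked zero    n = atoms n
  ranked (suc r) n = atoms n
    ++ List.map ∃⋀ (sublists (ranked r (suc n)))
    ++ List.map ∀⋁ (sublists (ranked r (suc n)))

  atoms⊆ranked : ∀ r {p} → p ∈ₗ atoms n → p ∈ₗ ranked r n
  atoms⊆ranked zero    = id
  atoms⊆ranked (suc r) = ∈-++⁺ˡ

  ∃⋀∈ranked : ∀ r {S} → S ∈ₗ sublists (ranked r (suc n)) → ∃⋀ S ∈ₗ ranked (suc r) n
  ∃⋀∈ranked r S∈ = ∈-++⁺ʳ (atoms _) (∈-++⁺ˡ (∈-map⁺ ∃⋀ S∈))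

  ∀⋁∈ranked : ∀ r {S} → S ∈ₗ sublists (ranked r (suc n)) → ∀⋁ S ∈ₗ ranked (suc r) n
  ∀⋁∈ranked r S∈ = ∈-++⁺ʳ (atoms _) (∈-++⁺ʳ (List.map ∃⋀ _) (∈-map⁺ ∀⋁ S∈))

  -- Back and forth from preservation of ranked formulas

  module _ (em : ExcludedMiddle ℓ) (𝕏 𝕐 : Structure L ℓ) where

    private
      X = Carrier 𝕏
      Y = Carrier 𝕐

    open IsPartialCondensation

    Transfers : Vec X n → Vec Y n → Pred (Positive L n) ℓ
    Transfers xs ys (φ , _) = Sat 𝕏 xs φ → Sat 𝕐 ys φ

    transfers⇒isPartialCondensation : {xs : Vec X n} {ys : Vec Y n} →
      (∀ {φ} (p : P₀ n φ) → Transfers xs ys (φ , base p)) →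
      IsPartialCondensation 𝕏 𝕐 (Link xs ys)
    transfers⇒isPartialCondensation t .functional (a , p , refl) (b , q , refl) =
      t (eq a b) (trans (sym p) q)
    transfers⇒isPartialCondensation t .injective (a , refl , p) (b , refl , q) =
      -- Injectivity is the contrapositive of preserving inequality.
      em⇒dne em λ x≢x′ → t (neq a b) x≢x′ (trans (sym p) q)
    transfers⇒isPartialCondensation {xs = xs} {ys} t .preserves i l
      with as , refl , refl ← Link-indices xs ys l =
      t (rel i as)

    module _ r {xs : Vec X n} {ys : Vec Y n}
             (t : ∀ {p} → p ∈ₗ ranked (suc r) n → Transfers xs ys p) where

      transfers-forth : ∀ x → ∃ λ y →
        ∀ {p} → p ∈ₗ ranked r (suc n) → Transfers (x ∷ xs) (y ∷ ys) p
      transfers-forth x = map₂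
        -- A formula true at `x` passed the filter, so it is a conjunct of `⋀ S`, which holds at
        -- `y`.
        (λ {y} s {p} p∈ px → All.lookup (⋀⁻ 𝕐 (y ∷ ys) S s) (∈-filter⁺ true? p∈ px))
        (t (∃⋀∈ranked r (filter-∈-sublists true? (ranked r (suc n))))
           (x , ⋀⁺ 𝕏 (x ∷ xs) (all-filter true? (ranked r (suc n)))))
        where
        true? : Decidable (λ p → Sat 𝕏 (x ∷ xs) (proj₁ p))
        true? _ = em
        S = filter true? (ranked r (suc n))

      transfers-back : ∀ y → ∃ λ x →
        ∀ {p} → p ∈ₗ ranked r (suc n) → Transfers (x ∷ xs) (y ∷ ys) p
      transfers-back y = map₂
        -- A formula true at `x` but false at `y` would be a disjunct making `⋁ S` true at `x`.
        (λ {x} ¬s {p} p∈ px → em⇒dne em λ ¬py →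
           ¬s (⋁⁺ 𝕏 (x ∷ xs) (lose (∈-filter⁺ false? p∈ ¬py) px)))
        (em⇒dne em λ ¬∃ →
           -- Without a counterexample `∀⋁ S` would hold in `𝕏`, hence in `𝕐`, and some member of
           -- `S` would be true at `y`.
           let ss = t (∀⋁∈ranked r (filter-∈-sublists false? (ranked r (suc n))))
                      (λ x → em⇒dne em λ ¬s → ¬∃ (x , ¬s)) y
           in All¬⇒¬Any (all-filter false? (ranked r (suc n))) (⋁⁻ 𝕐 (y ∷ ys) S ss))
        where
        false? : Decidable (λ p → ¬ Sat 𝕐 (y ∷ ys) (proj₁ p))
        false? _ = em
        S = filter false? (ranked r (suc n))

    transfers⇒BackForth : ∀ r {xs : Vec X n} {ys : Vec Y n} →
      (∀ {p} → p ∈ₗ ranked r n → Transfers xs ys p) → BackForth 𝕏 𝕐 r xs ys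
    transfers⇒BackForth zero    t = transfers⇒isPartialCondensation (t ∘ ∈-atoms)
    transfers⇒BackForth (suc r) t =
      transfers⇒isPartialCondensation (t ∘ atoms⊆ranked (suc r) ∘ ∈-atoms) ,
      (λ x → map₂ (transfers⇒BackForth r) (transfers-forth r t x)) ,
      (λ y → map₂ (transfers⇒BackForth r) (transfers-back r t y))

  ≼ᶜ-fin⇔⋘𝒫 : ExcludedMiddle ℓ → (𝕏 𝕐 : Structure L ℓ) → (𝕏 ≼ᶜ-fin 𝕐) ⇔ (𝕏 ⋘[ 𝒫 ] 𝕐)
  ≼ᶜ-fin⇔⋘𝒫 em 𝕏 𝕐 = mk⇔
    (λ b φ p → BackForth-preserves-𝒫 𝕏 𝕐 (rank φ) (b (rank φ)) p ≤-refl)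
    (λ t r → transfers⇒BackForth em 𝕏 𝕐 r λ {p} _ → t (proj₁ p) (proj₂ p))
    ⇔-∘ ≼ᶜ-fin⇔BackForth 𝕏 𝕐

-- Duality

dual : Formula L n → Formula L n
dual (a ≐ b)    = ~ (a ≐ b)
dual (rel i as) = ~ rel i as
dual (~ φ)      = φ
dual (φ ∧′ ψ)   = dual φ ∨′ dual ψ
dual (φ ∨′ ψ)   = dual φ ∧′ dual ψ
dual (∀′ φ)     = ∃′ (dual φ)
dual (∃′ φ)     = ∀′ (dual φ)

dual-closure : {B C : FormulaClass L} → (∀ {n φ} → B n φ → C n (dual φ)) →
               ∀ {n φ} → Closure B n φ → Closure C n (dual φ)
dual-closure d (base p)   = base (d p)
dual-closure d (conj p q) = disj (dual-closure d p) (dual-closure d q)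
dual-closure d (disj p q) = conj (dual-closure d p) (dual-closure d q)
dual-closure d (univ p)   = exis (dual-closure d p)
dual-closure d (exis p)   = univ (dual-closure d p)

dual-𝒫 : {φ : Formula L n} → 𝒫 n φ → 𝒩 n (dual φ)
dual-𝒫 = dual-closure λ where
  (eq a b)   → neq a b
  (rel i as) → nrel i as
  (neq a b)  → eq a b

dual-𝒩 : {φ : Formula L n} → 𝒩 n φ → 𝒫 n (dual φ)
dual-𝒩 = dual-closure λ where
  (nrel i as) → rel i as
  (eq a b)    → neq a b
  (neq a b)   → eq a b

Sat-dual⁻ : (𝕏 : Structure L ℓ) (ρ : Vec (Carrier 𝕏) n) (φ : Formula L n) →
            Sat 𝕏 ρ (dual φ) → ¬ Sat 𝕏 ρ φ
Sat-dual⁻ 𝕏 ρ (_ ≐ _)   d        s        = d s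
Sat-dual⁻ 𝕏 ρ (rel _ _) d        s        = d s
Sat-dual⁻ 𝕏 ρ (~ φ)     d        s        = s d
Sat-dual⁻ 𝕏 ρ (φ ∧′ ψ)  (inj₁ d) (s , _)  = Sat-dual⁻ 𝕏 ρ φ d s
Sat-dual⁻ 𝕏 ρ (φ ∧′ ψ)  (inj₂ d) (_ , s)  = Sat-dual⁻ 𝕏 ρ ψ d s
Sat-dual⁻ 𝕏 ρ (φ ∨′ ψ)  (d , _)  (inj₁ s) = Sat-dual⁻ 𝕏 ρ φ d s
Sat-dual⁻ 𝕏 ρ (φ ∨′ ψ)  (_ , d)  (inj₂ s) = Sat-dual⁻ 𝕏 ρ ψ d s
Sat-dual⁻ 𝕏 ρ (∀′ φ)    (x , d)  s        = Sat-dual⁻ 𝕏 (x ∷ ρ) φ d (s x)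
Sat-dual⁻ 𝕏 ρ (∃′ φ)    d        (x , s)  = Sat-dual⁻ 𝕏 (x ∷ ρ) φ (d x) s

module _ (em : ExcludedMiddle ℓ) where

  -- Excluded middle is used for `~`, to remove a double negation, and for `∧′` and `∀′`, to find
  -- the failing conjunct or instance.
  Sat-dual⁺ : (𝕏 : Structure L ℓ) (ρ : Vec (Carrier 𝕏) n) (φ : Formula L n) →
              ¬ Sat 𝕏 ρ φ → Sat 𝕏 ρ (dual φ)
  Sat-dual⁺ 𝕏 ρ (_ ≐ _)   ¬s = ¬s
  Sat-dual⁺ 𝕏 ρ (rel _ _) ¬s = ¬s
  Sat-dual⁺ 𝕏 ρ (~ φ)     ¬s = em⇒dne em ¬s
  Sat-dual⁺ 𝕏 ρ (φ ∧′ ψ)  ¬s with em {Sat 𝕏 ρ φ}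
  ... | yes s = inj₂ (Sat-dual⁺ 𝕏 ρ ψ λ t → ¬s (s , t))
  ... | no ¬t = inj₁ (Sat-dual⁺ 𝕏 ρ φ ¬t)
  Sat-dual⁺ 𝕏 ρ (φ ∨′ ψ)  ¬s = Sat-dual⁺ 𝕏 ρ φ (¬s ∘ inj₁) , Sat-dual⁺ 𝕏 ρ ψ (¬s ∘ inj₂)
  Sat-dual⁺ 𝕏 ρ (∀′ φ)    ¬s = em⇒dne em λ ¬∃ →
    ¬s λ x → em⇒dne em λ ¬t → ¬∃ (x , Sat-dual⁺ 𝕏 (x ∷ ρ) φ ¬t)
  Sat-dual⁺ 𝕏 ρ (∃′ φ)    ¬s x = Sat-dual⁺ 𝕏 (x ∷ ρ) φ λ t → ¬s (x , t)

  -- Contraposition: if `φ` failed in `𝕏`, its dual would hold in `𝕏`, hence in `𝕐`, against `φ`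
  -- there.
  ⋘-dual : (F G : FormulaClass L) → (∀ {φ} → F 0 φ → G 0 (dual φ)) →
           (𝕏 𝕐 : Structure L ℓ) → 𝕏 ⋘[ G ] 𝕐 → 𝕐 ⋘[ F ] 𝕏
  ⋘-dual F G d 𝕏 𝕐 t φ p s = em⇒dne em λ ¬s →
    Sat-dual⁻ 𝕐 [] φ (t (dual φ) (d p) (Sat-dual⁺ 𝕏 [] φ ¬s)) s

  ⋘𝒫⇔⋘𝒩 : (𝕏 𝕐 : Structure L ℓ) → (𝕏 ⋘[ 𝒫 ] 𝕐) ⇔ (𝕐 ⋘[ 𝒩 ] 𝕏)
  ⋘𝒫⇔⋘𝒩 𝕏 𝕐 = mk⇔ (⋘-dual 𝒩 𝒫 dual-𝒩 𝕏 𝕐) (⋘-dual 𝒫 𝒩 dual-𝒫 𝕐 𝕏)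

-- Combining the equivalences

≡[]⇔⋘×⋙ : (F : FormulaClass L) (𝕏 𝕐 : Structure L ℓ) →
           (𝕏 ≡[ F ] 𝕐) ⇔ (𝕏 ⋘[ F ] 𝕐 × 𝕐 ⋘[ F ] 𝕏)
≡[]⇔⋘×⋙ F 𝕏 𝕐 = mk⇔
  (λ e → (λ φ p → to (e φ p)) , (λ φ p → from (e φ p)))
  (λ (t , u) φ p → mk⇔ (t φ p) (u φ p))

⋘∪⇔⋘×⋘ : (F G : FormulaClass L) (𝕏 𝕐 : Structure L ℓ) →
          (𝕏 ⋘[ F ∪ᶜ G ] 𝕐) ⇔ (𝕏 ⋘[ F ] 𝕐 × 𝕏 ⋘[ G ] 𝕐)
⋘∪⇔⋘×⋘ F G 𝕏 𝕐 = mk⇔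
  (λ t → (λ φ → t φ ∘ inj₁) , (λ φ → t φ ∘ inj₂))
  (λ (t , u) φ → [ t φ , u φ ])

theorem5p1 : ∀ {ℓ} → ExcludedMiddle ℓ →
    (L : Language) → IsFinite L → (𝕏 𝕐 : Structure L ℓ) →
    ( ((𝕏 ≼ᶜ-fin 𝕐) ⇔ (∀ n → HasWinningStrategyII 𝕏 𝕐 n))
    × ((𝕏 ≼ᶜ-fin 𝕐) ⇔ (𝕏 ⋘[ 𝒫 ] 𝕐))
    × ((𝕏 ≼ᶜ-fin 𝕐) ⇔ (𝕐 ⋘[ 𝒩 ] 𝕏)) )
    ×
    ( (((𝕏 ≼ᶜ-fin 𝕐) × (𝕐 ≼ᶜ-fin 𝕏)) ⇔ (∀ n → HasWinningStrategyII 𝕏 𝕐 n × HasWinningStrategyII 𝕐 𝕏 n))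
    × (((𝕏 ≼ᶜ-fin 𝕐) × (𝕐 ≼ᶜ-fin 𝕏)) ⇔ (𝕏 ≡[ 𝒫 ] 𝕐))
    × (((𝕏 ≼ᶜ-fin 𝕐) × (𝕐 ≼ᶜ-fin 𝕏)) ⇔ (𝕏 ≡[ 𝒩 ] 𝕐))
    × (((𝕏 ≼ᶜ-fin 𝕐) × (𝕐 ≼ᶜ-fin 𝕏)) ⇔ (𝕏 ≡[ 𝒫 ∪ᶜ 𝒩 ] 𝕐))
    × (((𝕏 ≼ᶜ-fin 𝕐) × (𝕐 ≼ᶜ-fin 𝕏)) ⇔ (𝕏 ⋘[ 𝒫 ∪ᶜ 𝒩 ] 𝕐)) )
theorem5p1 {ℓ} em L finite 𝕏 𝕐 =
  (a⇔b 𝕏 𝕐 , a⇔c 𝕏 𝕐 , a⇔d 𝕏 𝕐) ,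
  ( mk⇔ (λ (a , a′) n → to (a⇔b 𝕏 𝕐) a n , to (a⇔b 𝕐 𝕏) a′ n)
        (λ w → from (a⇔b 𝕏 𝕐) (proj₁ ∘ w) , from (a⇔b 𝕐 𝕏) (proj₂ ∘ w))
  , ⇔-sym (≡[]⇔⋘×⋙ 𝒫 𝕏 𝕐) ⇔-∘ (a⇔c 𝕏 𝕐 ×-⇔ a⇔c 𝕐 𝕏)
  -- The exchange is needed because `𝒩` is preserved in the reverse direction.
  , ⇔-sym (≡[]⇔⋘×⋙ 𝒩 𝕏 𝕐) ⇔-∘ (mk⇔ swap swap ⇔-∘ (a⇔d 𝕏 𝕐 ×-⇔ a⇔d 𝕐 𝕏))
  , ⇔-sym (≡[]⇔⋘×⋙ (𝒫 ∪ᶜ 𝒩) 𝕏 𝕐) ⇔-∘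
      mk⇔ (λ (a , a′) → to (a⇔f 𝕏 𝕐) (a , a′) , to (a⇔f 𝕐 𝕏) (a′ , a))
          -- Preservation of the union in one direction already gives both relations.
          (from (a⇔f 𝕏 𝕐) ∘ proj₁)
  , a⇔f 𝕏 𝕐 )
  where
  a⇔b : (𝕏 𝕐 : Structure L ℓ) → (𝕏 ≼ᶜ-fin 𝕐) ⇔ (∀ n → HasWinningStrategyII 𝕏 𝕐 n)
  a⇔b 𝕏 𝕐 = ⇔-sym (hasWinningStrategyII⇔BackForth 𝕏 𝕐) ⇔-∘ ≼ᶜ-fin⇔BackForth 𝕏 𝕐
  a⇔c : (𝕏 𝕐 : Structure L ℓ) → (𝕏 ≼ᶜ-fin 𝕐) ⇔ (𝕏 ⋘[ 𝒫 ] 𝕐)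
  a⇔c = ≼ᶜ-fin⇔⋘𝒫 finite em
  a⇔d : (𝕏 𝕐 : Structure L ℓ) → (𝕏 ≼ᶜ-fin 𝕐) ⇔ (𝕐 ⋘[ 𝒩 ] 𝕏)
  a⇔d 𝕏 𝕐 = ⋘𝒫⇔⋘𝒩 em 𝕏 𝕐 ⇔-∘ a⇔c 𝕏 𝕐
  -- The `𝒩` half of preservation from `𝕏` to `𝕐` amounts to `𝕐 ≼ᶜ-fin 𝕏`.
  a⇔f : (𝕏 𝕐 : Structure L ℓ) → (𝕏 ≼ᶜ-fin 𝕐 × 𝕐 ≼ᶜ-fin 𝕏) ⇔ (𝕏 ⋘[ 𝒫 ∪ᶜ 𝒩 ] 𝕐)
  a⇔f 𝕏 𝕐 = ⇔-sym (⋘∪⇔⋘×⋘ 𝒫 𝒩 𝕏 𝕐) ⇔-∘ (a⇔c 𝕏 𝕐 ×-⇔ a⇔d 𝕐 𝕏)
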